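{- If a finite simple graph $G$ admits an MAT-labeling, then $G$ is strongly chordal.
   Context: MAT-labeling: for $\lambda:E_G\to\mathbb{Z}_{>0}$ put $\pi_k=\lambda^{ -1}(k)$, $E_k=\pi_1\sqcup\dots\sqcup\pi_k$, $E_0=\varnothing$; $\operatorname{cl}(F)$ is the set of edges whose endvertices are joined by a path of edges in $F$; $\lambda$ is an MAT-labeling if for all $k\ge1$: (ML1) $\pi_k$ is a forest; (ML2) $\operatorname{cl}(\pi_k)\cap E_{k-1}=\varnothing$; (ML3) each $\{u,v\}\in\pi_k$ has exactly $k-1$ vertices $w$ with $\{u,w\},\{v,w\}\in E_{k-1}$. A graph is chordal if it has no induced cycle of length greater than three. For $n\ge3$, the $n$-sun $S_n$ has vertices $u_1,\dots,u_n,w_1,\dots,w_n$ and edges $\{u_i,u_j\}$ ($i<j$), $\{w_i,u_i\}$, $\{w_i,u_{i+1}\}$ (indices mod $n$). A graph is strongly chordal if it is chordal and has no induced subgraph isomorphic to any $S_n$, $n\ge3$. -}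

module Defs where

open import Data.Nat using (ℕ; zero; suc; _+_; _∸_; _≤_)
open import Data.Nat.DivMod using (_mod_)
open import Data.Fin using (Fin; toℕ)
open import Data.Bool using (Bool; T)
open import Data.Product using (Σ; ∃; _×_)
open import Data.Sum using (_⊎_; inj₁; inj₂)
open import Data.Empty using (⊥)
open import Relation.Nullary using (¬_)
open import Relation.Binary.PropositionalEquality using (_≡_; _≢_)
open import Relation.Binary.Construct.Closure.ReflexiveTransitive using (Star)
open import Function.Definitions using (Injective)
open import Function.Bundles using (_↔_; _⇔_)

record Graph : Set where
  field
    n      : ℕ
    adj    : Fin n → Fin n → Bool
    sym    : ∀ u v → adj u v ≡ adj v u
    irrefl : ∀ u → adj u u ≡ Data.Bool.false

open Graph public

Edge : (G : Graph) → Fin (n G) → Fin (n G) → Set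
Edge G u v = T (adj G u v)

next : {m : ℕ} → Fin (suc m) → Fin (suc m)
next {m} i = suc (toℕ i) mod (suc m)

HasInducedCopy : (G : Graph) (V : Set) (H : V → V → Set) → Set
HasInducedCopy G V H =
  Σ (V → Fin (n G)) λ φ → Injective _≡_ _≡_ φ × (∀ x y → Edge G (φ x) (φ y) ⇔ H x y)

CycleAdj : (k : ℕ) → Fin (suc k) → Fin (suc k) → Set
CycleAdj k i j = (j ≡ next i) ⊎ (i ≡ next j)

Chordal : Graph → Set
Chordal G = ∀ (k : ℕ) → 3 ≤ k → ¬ HasInducedCopy G (Fin (suc k)) (CycleAdj k)
-- (suc k ≥ 4, i.e. no induced cycle of length greater than three)

-- the sun S_m with m = suc k, vertices u_i = inj₁ i, w_i = inj₂ i
SunAdj : (k : ℕ) → Fin (suc k) ⊎ Fin (suc k) → Fin (suc k) ⊎ Fin (suc k) → Set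
SunAdj k (inj₁ i) (inj₁ j) = i ≢ j
SunAdj k (inj₂ i) (inj₁ j) = (j ≡ i) ⊎ (j ≡ next i)
SunAdj k (inj₁ j) (inj₂ i) = (j ≡ i) ⊎ (j ≡ next i)
SunAdj k (inj₂ i) (inj₂ j) = ⊥

StronglyChordal : Graph → Set
StronglyChordal G =
  Chordal G × (∀ (k : ℕ) → 2 ≤ k → ¬ HasInducedCopy G (Fin (suc k) ⊎ Fin (suc k)) (SunAdj k))

module _ (G : Graph) where

  HasCycle : (Fin (n G) → Fin (n G) → Set) → Set
  HasCycle F = Σ ℕ λ m → Σ (Fin (suc (suc (suc m))) → Fin (n G)) λ c →
                 Injective _≡_ _≡_ c × (∀ i → F (c i) (c (next i)))

  Forest : (Fin (n G) → Fin (n G) → Set) → Set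
  Forest F = ¬ HasCycle F

  cl : (Fin (n G) → Fin (n G) → Set) → Fin (n G) → Fin (n G) → Set
  cl F u v = Edge G u v × Star F u v

  -- a labelling of the edges: lab u v is the label of the edge {u,v}
  -- (values on non-edges are irrelevant)
  record Labeling : Set where
    field
      lab     : Fin (n G) → Fin (n G) → ℕ
      lab-sym : ∀ u v → Edge G u v → lab u v ≡ lab v u
      lab-pos : ∀ u v → Edge G u v → 1 ≤ lab u v

  module _ (L : Labeling) where
    open Labeling L

    π : ℕ → Fin (n G) → Fin (n G) → Set
    π k u v = Edge G u v × lab u v ≡ k

    -- E_k = π_1 ⊔ … ⊔ π_k  (labels are positive, so E_0 = ∅)
    Eₖ : ℕ → Fin (n G) → Fin (n G) → Set
    Eₖ k u v = Edge G u v × lab u v ≤ k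

    record IsMAT : Set where
      field
        ML1 : ∀ k → 1 ≤ k → Forest (π k)
        ML2 : ∀ k → 1 ≤ k → ∀ u v → cl (π k) u v → ¬ Eₖ (k ∸ 1) u v
        ML3 : ∀ k → 1 ≤ k → ∀ u v → π k u v →
              Fin (k ∸ 1) ↔ Σ (Fin (n G)) (λ w → Eₖ (k ∸ 1) u w × Eₖ (k ∸ 1) v w)

  HasMATLabeling : Set
  HasMATLabeling = Σ Labeling IsMAT

{-# OPTIONS --safe #-}

-- By ML1 and ML2 the maximal label in a triangle is attained once, so by ML3 a clique with
-- labels at most j has at most j + 1 vertices.  Chordality of the graph E j of labels at most j
-- goes by induction on j, adding the edges of label j + 1 one at a time: if {u , v} closes a long
-- induced cycle, the j common neighbours of u and v form a clique joined to the whole cycle, and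
-- the size bounds force every edge of the cycle to have label j + 1, against ML1.
--
-- Hence an edge e of label k, with its k - 1 common neighbours of lower label, is a clique (the
-- principal clique of e), and a principal clique containing e contains that of e.  So a vertex
-- adjacent to both ends of e is adjacent to the whole principal clique of e, which excludes suns.
module Submission where

open import Data.Bool using (T)
open import Data.Bool.Properties using (T?; T-irrelevant)
open import Data.Empty using (⊥; ⊥-elim)
open import Data.Fin as Fin using (Fin; toℕ; fromℕ; inject₁)
open import Data.Fin.Properties using (_≟_; toℕ-injective; toℕ-fromℕ<; toℕ<n; toℕ-fromℕ; toℕ-inject₁)
open import Data.List using (List; []; _∷_; length; filter; tabulate; allFin; cartesianProduct)
open import Data.List.Extrema.Nat using (argmax; f[xs]≤f[argmax])
open import Data.List.Membership.Propositional using (_∈_; _∉_; find; lose)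
import Data.List.Membership.DecPropositional as DecMembership
open import Data.List.Membership.Propositional.Properties using (∈-filter⁺; ∈-filter⁻; ∈-tabulate⁺; ∈-tabulate⁻; ∈-cartesianProduct⁺; ∈-allFin)
open import Data.List.Properties using (filter-all; filter-notAll; length-tabulate)
open import Data.List.Relation.Unary.All as All using ([]; _∷_)
open import Data.List.Relation.Unary.AllPairs using ([]; _∷_)
open import Data.List.Relation.Unary.Any using (here; there; any?)
open import Data.List.Relation.Unary.Unique.Propositional using (Unique)
open import Data.List.Relation.Unary.Unique.Propositional.Properties using (filter⁺; tabulate⁺)
open import Data.Nat using (ℕ; zero; suc; _+_; _∸_; _≤_; _<_; z≤n; s≤s; s≤s⁻¹; _≤?_)
open import Data.Nat.DivMod using (_mod_; _%_; m<n⇒m%n≡m; n%n≡0)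
open import Data.Nat.Properties as ℕ using (≤-refl; ≤-trans; ≤-reflexive; <⇒≤; <⇒≱; <-irrefl; ≤-irrelevant; n≤1+n; m≤m+n; +-suc; +-identityʳ; +-cancelˡ-≡; +-monoʳ-≤; +-monoʳ-<; m≤n⇒m<n∨m≡n; m+[n∸m]≡n)
open import Data.Product using (Σ; ∃; _×_; _,_; proj₁; proj₂; uncurry)
open import Data.Product.Properties using (≡-dec)
open import Data.Sum using (_⊎_; inj₁; inj₂; [_,_]′)
open import Function using (_∘_)
open import Function.Bundles using (Equivalence; Inverse)
open import Relation.Binary.Construct.Closure.ReflexiveTransitive using (ε; _◅_)
open import Relation.Binary.Definitions using (Symmetric; Decidable)
open import Relation.Binary.PropositionalEquality as ≡ using (_≡_; _≢_; refl; cong; subst; subst₂; trans)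
open import Relation.Nullary using (¬_; yes; no; contradiction)
open import Relation.Nullary.Decidable using (¬?; _×-dec_; _⊎-dec_; decidable-stable)

open import Defs

-- Duplicate-free lists, induced paths and induced cycles.

module _ {N : ℕ} where

  infixl 20 _∖_

  _∖_ : List (Fin N) → Fin N → List (Fin N)
  xs ∖ w = filter (λ y → ¬? (y ≟ w)) xs

  ∈-∖⁺ : ∀ {xs w y} → y ∈ xs → y ≢ w → y ∈ xs ∖ w
  ∈-∖⁺ {w = w} = ∈-filter⁺ (λ y → ¬? (y ≟ w))

  ∈-∖⁻ : ∀ {xs w y} → y ∈ xs ∖ w → y ∈ xs × y ≢ w
  ∈-∖⁻ {xs} {w} = ∈-filter⁻ (λ y → ¬? (y ≟ w)) {xs = xs}

  Unique-∖ : ∀ {xs} w → Unique xs → Unique (xs ∖ w)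
  Unique-∖ w = filter⁺ (λ y → ¬? (y ≟ w))

  length-∖ : ∀ {xs} w → Unique xs → length xs ≤ suc (length (xs ∖ w))
  length-∖ w [] = z≤n
  length-∖ {x ∷ xs} w (x∉ ∷ u) with x ≟ w
  ... | no  _    = s≤s (length-∖ w u)
  ... | yes refl = s≤s (≤-reflexive (≡.sym (cong length
                     (filter-all (λ y → ¬? (y ≟ w)) (All.map (λ x≢y y≡x → x≢y (≡.sym y≡x)) x∉)))))

  length-⊆ : ∀ {xs ys} → Unique xs → (∀ {x} → x ∈ xs → x ∈ ys) → length xs ≤ length ys
  length-⊆ [] _ = z≤n
  length-⊆ {x ∷ xs} {ys} (x∉ ∷ u) sub = ≤-trans
    (s≤s (length-⊆ u λ y∈ → ∈-∖⁺ (sub (there y∈)) λ y≡x → All.lookup x∉ y∈ (≡.sym y≡x)))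
    (filter-notAll (λ y → ¬? (y ≟ x)) ys (lose (sub (here refl)) λ ¬x≡x → ¬x≡x refl))

  Clique : (Fin N → Fin N → Set) → List (Fin N) → Set
  Clique R xs = Unique xs × (∀ {x y} → x ∈ xs → y ∈ xs → x ≢ y → R x y)

  -- For symmetric `R` these are the induced paths. The vertices are given by a total function on
  -- `ℕ`, to keep index arithmetic plain; only its values up to `m` are constrained.
  record Path (R : Fin N → Fin N → Set) (m : ℕ) (p : ℕ → Fin N) : Set where
    field
      inj   : ∀ {i j} → i ≤ m → j ≤ m → p i ≡ p j → i ≡ j
      step  : ∀ {i} → i < m → R (p i) (p (suc i))
      chord : ∀ {i j} → i < j → j ≤ m → R (p i) (p j) → j ≡ suc i

  -- The vertices are p 0, …, p m, so the length of the cycle is suc m.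
  record Cycle (R : Fin N → Fin N → Set) (m : ℕ) (p : ℕ → Fin N) : Set where
    field
      inj   : ∀ {i j} → i ≤ m → j ≤ m → p i ≡ p j → i ≡ j
      step  : ∀ {i} → i < m → R (p i) (p (suc i))
      close : R (p m) (p 0)
      chord : ∀ {i j} → i < j → j ≤ m → R (p i) (p j) → j ≡ suc i ⊎ (i ≡ 0 × j ≡ m)

  -- Chordality for symmetric `R`: a cycle with last index `m ≥ 3` has at least four vertices.
  NoCycle : (Fin N → Fin N → Set) → Set
  NoCycle R = ∀ {m p} → 3 ≤ m → ¬ Cycle R m p

  -- Rotation of cycles, and cones over induced paths in chordal graphs.

  module _ {R : Fin N → Fin N → Set} (R-sym : Symmetric R) where

    rotate : ℕ → (ℕ → Fin N) → ℕ → Fin N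
    rotate m p i with i ℕ.≟ m
    ... | yes _ = p 0
    ... | no  _ = p (suc i)

    rotate-< : ∀ {m} p {i} → i < m → rotate m p i ≡ p (suc i)
    rotate-< {m} p {i} i<m with i ℕ.≟ m
    ... | yes refl = contradiction i<m (<-irrefl refl)
    ... | no  _    = refl

    rotate-≡ : ∀ m p → rotate m p m ≡ p 0
    rotate-≡ m p with m ℕ.≟ m
    ... | yes _   = refl
    ... | no  m≢m = contradiction refl m≢m

    rotate-Cycle : ∀ {m p} → 1 ≤ m → Cycle R m p → Cycle R m (rotate m p)
    rotate-Cycle {m} {p} 1≤m C = record { inj = inj′ ; step = step′ ; close = close′ ; chord = chord′ }
      where
      open Cycle C
      inj′ : ∀ {i j} → i ≤ m → j ≤ m → rotate m p i ≡ rotate m p j → i ≡ j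
      inj′ {i} {j} i≤m j≤m eq with m≤n⇒m<n∨m≡n i≤m | m≤n⇒m<n∨m≡n j≤m
      ... | inj₂ refl | inj₂ refl = refl
      ... | inj₁ i<m  | inj₁ j<m  = ℕ.suc-injective (inj i<m j<m (trans (≡.sym (rotate-< p i<m)) (trans eq (rotate-< p j<m))))
      ... | inj₁ i<m  | inj₂ refl with () ← inj i<m z≤n (trans (≡.sym (rotate-< p i<m)) (trans eq (rotate-≡ m p)))
      ... | inj₂ refl | inj₁ j<m  with () ← inj j<m z≤n (trans (≡.sym (rotate-< p j<m)) (trans (≡.sym eq) (rotate-≡ m p)))
      step′ : ∀ {i} → i < m → R (rotate m p i) (rotate m p (suc i))
      step′ {i} i<m rewrite rotate-< p i<m with m≤n⇒m<n∨m≡n i<m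
      ... | inj₁ 1+i<m rewrite rotate-< p 1+i<m = step 1+i<m
      ... | inj₂ refl  rewrite rotate-≡ m p     = close
      close′ : R (rotate m p m) (rotate m p 0)
      close′ rewrite rotate-≡ m p | rotate-< p 1≤m = step 1≤m
      chord′ : ∀ {i j} → i < j → j ≤ m → R (rotate m p i) (rotate m p j) → j ≡ suc i ⊎ (i ≡ 0 × j ≡ m)
      chord′ {i} {j} i<j j≤m r with m≤n⇒m<n∨m≡n j≤m
      chord′ {i} {j} i<j j≤m r | inj₁ j<m
        with chord (s≤s i<j) j<m (subst₂ R (rotate-< p (ℕ.<-≤-trans i<j j≤m)) (rotate-< p j<m) r)
      ... | inj₁ eq = inj₁ (ℕ.suc-injective eq)
      chord′ {i} i<j j≤m r | inj₂ refl
        with chord (s≤s z≤n) i<j (R-sym (subst₂ R (rotate-< p i<j) (rotate-≡ m p) r))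
      ... | inj₁ eq       = inj₂ (ℕ.suc-injective eq , refl)
      ... | inj₂ (_ , eq) = inj₁ (≡.sym eq)

    -- Lets any chosen edge of a cycle be taken as its closing edge, so that the rest of the cycle
    -- is a path.
    rotate-to : ∀ {m p} → 1 ≤ m → Cycle R m p → ∀ i → i < m →
                ∃ λ q → Cycle R m q × q m ≡ p i × q 0 ≡ p (suc i)
    rotate-to {m} {p} 1≤m C zero i<m =
      rotate m p , rotate-Cycle 1≤m C , rotate-≡ m p , rotate-< p 1≤m
    rotate-to {m} {p} 1≤m C (suc i) i<m
      with q , D , q≡ , q₀≡ ← rotate-to 1≤m (rotate-Cycle 1≤m C) i (<⇒≤ i<m) =
      q , D , trans q≡ (rotate-< p (<⇒≤ i<m)) , trans q₀≡ (rotate-< p i<m)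

    module _ (R? : Decidable R) (noCycle : NoCycle R) {m p w} (P : Path R m p)
             (w∉p : ∀ {i} → i ≤ m → w ≢ p i) (w-first : R w (p 0)) (w-last : R w (p m)) where
      open Path P

      private
        cone : ℕ → ℕ → Fin N
        cone a zero    = w
        cone a (suc i) = p (a + i)

        -- If w is adjacent to p a and p (a + 1 + t) but to nothing in between, a long cycle appears.
        cone-Cycle : ∀ {a t} → a + suc t ≤ m → R w (p a) → R w (p (a + suc t)) →
                     (∀ {s} → 1 ≤ s → s ≤ t → ¬ R w (p (a + s))) → Cycle R (suc (suc t)) (cone a)
        cone-Cycle {a} {t} a+t≤m wa wt gap = record
          { inj = inj′ ; step = step′ ; close = R-sym wt ; chord = chord′ }
          where
          bound : ∀ {i} → i ≤ suc t → a + i ≤ m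
          bound i≤ = ≤-trans (+-monoʳ-≤ a i≤) a+t≤m
          inj′ : ∀ {i j} → i ≤ suc (suc t) → j ≤ suc (suc t) → cone a i ≡ cone a j → i ≡ j
          inj′ {zero}  {zero}  _ _ _ = refl
          inj′ {zero}  {suc j} _ (s≤s j≤) eq = contradiction eq (w∉p (bound j≤))
          inj′ {suc i} {zero}  (s≤s i≤) _ eq = contradiction (≡.sym eq) (w∉p (bound i≤))
          inj′ {suc i} {suc j} (s≤s i≤) (s≤s j≤) eq = cong suc (+-cancelˡ-≡ a i j (inj (bound i≤) (bound j≤) eq))
          step′ : ∀ {i} → i < suc (suc t) → R (cone a i) (cone a (suc i))
          step′ {zero}  _ = subst (R w ∘ p) (≡.sym (+-identityʳ a)) wa
          step′ {suc i} (s≤s i<) = subst (R (p (a + i)) ∘ p) (≡.sym (+-suc a i))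
            (step (≤-trans (≤-reflexive (≡.sym (+-suc a i))) (bound i<)))
          chord′ : ∀ {i j} → i < j → j ≤ suc (suc t) → R (cone a i) (cone a j) → j ≡ suc i ⊎ (i ≡ 0 × j ≡ suc (suc t))
          chord′ {zero} {suc zero} _ _ _ = inj₁ refl
          chord′ {zero} {suc (suc j)} _ (s≤s j≤) r with m≤n⇒m<n∨m≡n j≤
          ... | inj₁ (s≤s j<t) = contradiction r (gap (s≤s z≤n) j<t)
          ... | inj₂ refl      = inj₂ (refl , refl)
          chord′ {suc i} {suc j} (s≤s i<j) (s≤s j≤) r = inj₁ (cong suc (+-cancelˡ-≡ a j (suc i)
            (trans (chord (+-monoʳ-< a i<j) (bound j≤) r) (≡.sym (+-suc a i)))))

        -- Search for the next neighbour of `w` after a gap of `t` non-neighbours, with `r` vertices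
        -- of the path left. It succeeds at `p m` at the latest, and `1 ≤ t` gives the resulting
        -- cycle at least four vertices.
        scan : ∀ {a} → R w (p a) → ∀ r t → (a + t) + r ≡ m → 1 ≤ t →
               ¬ (∀ {s} → 1 ≤ s → s ≤ t → ¬ R w (p (a + s)))
        scan {a} wa zero t eq 1≤t gap =
          gap 1≤t ≤-refl (subst (R w ∘ p) (trans (≡.sym eq) (+-identityʳ (a + t))) w-last)
        scan {a} wa (suc r) t eq 1≤t gap with R? w (p (a + suc t))
        ... | yes wt = noCycle (s≤s (s≤s 1≤t)) (cone-Cycle (subst (a + suc t ≤_) eq′ (m≤m+n (a + suc t) r)) wa wt gap)
          where
          eq′ : (a + suc t) + r ≡ m
          eq′ = trans (cong (_+ r) (+-suc a t)) (trans (≡.sym (+-suc (a + t) r)) eq)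
        ... | no ¬wt = scan wa r (suc t) (trans (cong (_+ r) (+-suc a t)) (trans (≡.sym (+-suc (a + t) r)) eq)) (s≤s z≤n)
          λ 1≤s s≤ → [ (λ { (s≤s s≤t) → gap 1≤s s≤t }) , (λ { refl → ¬wt }) ]′ (m≤n⇒m<n∨m≡n s≤)

      -- A first non-neighbour of `w` along the path would come right after a neighbour and start a
      -- gap of length one, which `scan` refutes.
      cone-complete : ∀ i → i ≤ m → R w (p i)
      cone-complete zero    _   = w-first
      cone-complete (suc i) i<m with R? w (p (suc i))
      ... | yes r = r
      ... | no ¬r = ⊥-elim (scan (cone-complete i (<⇒≤ i<m)) (m ∸ (i + 1)) 1
                      (m+[n∸m]≡n (subst (_≤ m) (ℕ.+-comm 1 i) i<m)) ≤-refl gap)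
        where
        gap : ∀ {s} → 1 ≤ s → s ≤ 1 → ¬ R w (p (i + s))
        gap (s≤s z≤n) (s≤s z≤n) r = ¬r (subst (R w ∘ p) (ℕ.+-comm i 1) r)

  Clique-∷ : ∀ {R x xs} → Symmetric R → Clique R xs → x ∉ xs → (∀ {y} → y ∈ xs → R x y) → Clique R (x ∷ xs)
  Clique-∷ {R} {x} {xs} R-sym (u , cl) x∉ Rx = All.tabulate (λ y∈ x≡y → x∉ (subst (_∈ xs) (≡.sym x≡y) y∈)) ∷ u , cl′
    where
    cl′ : ∀ {y z} → y ∈ x ∷ xs → z ∈ x ∷ xs → y ≢ z → R y z
    cl′ (here refl) (here refl) y≢z = contradiction refl y≢z
    cl′ (here refl) (there z∈)  _   = Rx z∈
    cl′ (there y∈)  (here refl) _   = R-sym (Rx y∈)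
    cl′ (there y∈)  (there z∈)  y≢z = cl y∈ z∈ y≢z

  NoCycle-resp : ∀ {A B : Fin N → Fin N → Set} → (∀ {x y} → A x y → B x y) → (∀ {x y} → B x y → A x y) →
                 NoCycle A → NoCycle B
  NoCycle-resp A⊆B B⊆A noA 3≤m C = noA 3≤m record
    { inj = inj ; step = B⊆A ∘ step ; close = B⊆A close ; chord = λ i<j j≤m → chord i<j j≤m ∘ A⊆B }
    where open Cycle C

next-< : ∀ {m} (i : Fin (suc m)) → toℕ i < m → toℕ (next i) ≡ suc (toℕ i)
next-< i i<m = trans (toℕ-fromℕ< _) (m<n⇒m%n≡m (s≤s i<m))

next-last : ∀ {m} (i : Fin (suc m)) → toℕ i ≡ m → toℕ (next i) ≡ 0
next-last {m} i i≡m = trans (toℕ-fromℕ< _) (trans (cong (λ t → suc t % suc m) i≡m) (n%n≡0 (suc m)))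

-- Consequences of the labeling axioms: triangles, common neighbours, clique sizes.

module MAT (G : Graph) (L : Labeling G) (mat : IsMAT G L) where
  open Labeling L
  open IsMAT mat

  V : Set
  V = Fin (n G)

  E : ℕ → V → V → Set
  E = Eₖ G L

  Common : ℕ → V → V → V → Set
  Common j u v w = E j u w × E j v w

  Edge-sym : Symmetric (Edge G)
  Edge-sym {x} {y} = subst T (Defs.sym G x y)

  Edge-irrefl : ∀ {x y} → Edge G x y → x ≢ y
  Edge-irrefl {x} e refl = subst T (irrefl G x) e

  E-sym : ∀ {j} → Symmetric (E j)
  E-sym {j} {x} {y} (e , l) = Edge-sym e , subst (_≤ j) (lab-sym x y e) l

  E? : ∀ j → Decidable (E j)
  E? j x y = T? (adj G x y) ×-dec (lab x y ≤? j)

  E-suc : ∀ {j x y} → E j x y → E (suc j) x y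
  E-suc (e , l) = e , ≤-trans l (n≤1+n _)

  π-sym : ∀ {k} → Symmetric (π G L k)
  π-sym {k} {x} {y} (e , l) = Edge-sym e , trans (≡.sym (lab-sym x y e)) l

  E-suc⁻ : ∀ {j x y} → E (suc j) x y → E j x y ⊎ π G L (suc j) x y
  E-suc⁻ (e , l) with m≤n⇒m<n∨m≡n l
  ... | inj₁ (s≤s l≤j) = inj₁ (e , l≤j)
  ... | inj₂ eq        = inj₂ (e , eq)

  π⇒¬E : ∀ {j x y} → π G L (suc j) x y → ¬ E j x y
  π⇒¬E (_ , eq) (_ , l) = <-irrefl refl (≤-trans (≤-reflexive (≡.sym eq)) l)

  E₀-empty : ∀ {x y} → ¬ E 0 x y
  E₀-empty {x} {y} (e , l) = <⇒≱ (lab-pos x y e) l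

  -- `ML1` for cycles indexed by `ℕ`; the last index `2 + m` matches the `3 + m` vertices of
  -- `HasCycle`.
  π-acyclic : ∀ {j m} {p : ℕ → V} → (∀ {i j} → i ≤ 2 + m → j ≤ 2 + m → p i ≡ p j → i ≡ j) →
              (∀ {i} → i < 2 + m → π G L (suc j) (p i) (p (suc i))) → ¬ π G L (suc j) (p (2 + m)) (p 0)
  π-acyclic {j} {m} {p} inj step close = ML1 (suc j) (s≤s z≤n)
    (m , p ∘ toℕ , (λ {i} {i′} eq → toℕ-injective (inj (s≤s⁻¹ (toℕ<n i)) (s≤s⁻¹ (toℕ<n i′)) eq)) , step′)
    where
    step′ : ∀ i → π G L (suc j) (p (toℕ i)) (p (toℕ (next i)))
    step′ i with m≤n⇒m<n∨m≡n (s≤s⁻¹ (toℕ<n i))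
    ... | inj₁ i<m rewrite next-< i i<m = step i<m
    ... | inj₂ i≡m rewrite next-last i i≡m | i≡m = close

  -- If the third edge had a smaller label, it would lie in the closure of `π (suc j)`, against
  -- `ML2`; with the same label the triangle would be a cycle, against `ML1`.
  triangle-⊥ : ∀ {j x y z} → π G L (suc j) x y → π G L (suc j) y z → ¬ E (suc j) x z
  triangle-⊥ {j} {x} {y} {z} xy yz xz with E-suc⁻ xz
  ... | inj₁ xz′ = ML2 (suc j) (s≤s z≤n) x z (proj₁ xz , xy ◅ yz ◅ ε) xz′
  ... | inj₂ xz′ = π-acyclic {p = p} inj step (π-sym xz′)
    where
    p : ℕ → V
    p 0 = x
    p 1 = y
    p _ = z
    x≢y = Edge-irrefl (proj₁ xy)
    y≢z = Edge-irrefl (proj₁ yz)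
    x≢z = Edge-irrefl (proj₁ xz)
    inj : ∀ {i j} → i ≤ 2 → j ≤ 2 → p i ≡ p j → i ≡ j
    inj {0} {0} _ _ _ = refl
    inj {0} {1} _ _ eq = contradiction eq x≢y
    inj {0} {2} _ _ eq = contradiction eq x≢z
    inj {1} {0} _ _ eq = contradiction (≡.sym eq) x≢y
    inj {1} {1} _ _ _ = refl
    inj {1} {2} _ _ eq = contradiction eq y≢z
    inj {2} {0} _ _ eq = contradiction (≡.sym eq) x≢z
    inj {2} {1} _ _ eq = contradiction (≡.sym eq) y≢z
    inj {2} {2} _ _ _ = refl
    inj {suc (suc (suc _))} (s≤s (s≤s ()))
    inj {_} {suc (suc (suc _))} _ (s≤s (s≤s ()))
    step : ∀ {i} → i < 2 → π G L (suc j) (p i) (p (suc i))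
    step {0} _ = xy
    step {1} _ = yz
    step {suc (suc _)} (s≤s (s≤s ()))

  -- By `triangle-⊥` no second edge of the triangle has label `suc j`. This brings common neighbours
  -- down to the level where `ML3` counts them.
  absorb : ∀ {j x y z} → π G L (suc j) x y → Common (suc j) x y z → Common j x y z
  absorb xy (xz , yz) with E-suc⁻ xz | E-suc⁻ yz
  ... | inj₁ xz′ | inj₁ yz′ = xz′ , yz′
  ... | inj₂ xz′ | _        = ⊥-elim (triangle-⊥ (π-sym xy) xz′ yz)
  ... | _        | inj₂ yz′ = ⊥-elim (triangle-⊥ xy yz′ xz)

  common-neighbours : ∀ {j u v} → π G L (suc j) u v →
    ∃ λ ns → Unique ns × length ns ≡ j × (∀ {w} → w ∈ ns → Common j u v w) × (∀ {w} → Common j u v w → w ∈ ns)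
  common-neighbours {j} {u} {v} uv = tabulate f , tabulate⁺ f-inj , length-tabulate f , sound , complete
    where
    open Inverse (ML3 (suc j) (s≤s z≤n) u v uv)
    f : Fin j → V
    f = proj₁ ∘ to
    -- `ML3` counts pairs of a vertex and a proof; uniqueness of the proof turns this into a count
    -- of vertices.
    irrelevant : ∀ {w} (c d : Common j u v w) → c ≡ d
    irrelevant ((e , l) , (e′ , l′)) ((f , m) , (f′ , m′))
      rewrite T-irrelevant e f | T-irrelevant e′ f′ | ≤-irrelevant l m | ≤-irrelevant l′ m′ = refl
    Σ-≡ : ∀ {s t : Σ V (Common j u v)} → proj₁ s ≡ proj₁ t → s ≡ t
    Σ-≡ {w , c} {.w , d} refl = cong (w ,_) (irrelevant c d)
    f-inj : ∀ {i i′} → f i ≡ f i′ → i ≡ i′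
    f-inj {i} {i′} eq = trans (≡.sym (strictlyInverseʳ i)) (trans (cong from (Σ-≡ eq)) (strictlyInverseʳ i′))
    sound : ∀ {w} → w ∈ tabulate f → Common j u v w
    sound w∈ with i , refl ← ∈-tabulate⁻ w∈ = proj₂ (to i)
    complete : ∀ {w} → Common j u v w → w ∈ tabulate f
    complete c = subst (_∈ tabulate f) (cong proj₁ (strictlyInverseˡ (_ , c))) (∈-tabulate⁺ (from (_ , c)))

  common-bound : ∀ {j u v xs} → π G L (suc j) u v → Unique xs → (∀ {x} → x ∈ xs → Common j u v x) → length xs ≤ j
  common-bound uv uniq sub with ns , _ , len , _ , complete ← common-neighbours uv =
    subst (_ ≤_) len (length-⊆ uniq (complete ∘ sub))

  clique-lower : ∀ {j xs} → Clique (E (suc j)) xs →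
    (∃ λ c → ∃ λ d → c ∈ xs × d ∈ xs × π G L (suc j) c d) ⊎ Clique (E j) xs
  clique-lower {j} {xs} (uniq , adj) with any? (λ c → any? (λ d → ¬? (c ≟ d) ×-dec (lab c d ℕ.≟ suc j)) xs) xs
  ... | yes p with c , c∈ , q ← find p with d , d∈ , c≢d , eq ← find q =
    inj₁ (c , d , c∈ , d∈ , proj₁ (adj c∈ d∈ c≢d) , eq)
  ... | no ¬p = inj₂ (uniq , λ {x} {y} x∈ y∈ x≢y →
    [ (λ e → e) , (λ { (_ , eq) → ⊥-elim (¬p (lose x∈ (lose y∈ (x≢y , eq)))) }) ]′ (E-suc⁻ (adj x∈ y∈ x≢y)))

  clique-rest : ∀ {j xs c d x} → Clique (E (suc j)) xs → c ∈ xs → d ∈ xs → π G L (suc j) c d →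
                x ∈ xs ∖ c ∖ d → Common j c d x
  clique-rest (_ , adj) c∈ d∈ cd x∈
    with x∈′ , x≢d ← ∈-∖⁻ x∈ with x∈″ , x≢c ← ∈-∖⁻ x∈′ =
    absorb cd (adj c∈ x∈″ (x≢c ∘ ≡.sym) , adj d∈ x∈″ (x≢d ∘ ≡.sym))

  -- If some edge has the top label, all vertices other than its two ends are common neighbours that
  -- `ML3` counts; if none has, the bound one level lower applies.
  clique-bound : ∀ j {xs} → Clique (E j) xs → length xs ≤ suc j
  clique-bound zero {[]}         _         = z≤n
  clique-bound zero {_ ∷ []}     _         = s≤s z≤n
  clique-bound zero {_ ∷ _ ∷ _} (((x≢y ∷ _) ∷ _) , adj) = ⊥-elim (E₀-empty (adj (here refl) (there (here refl)) x≢y))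
  clique-bound (suc j) {xs} K@(uniq , _) with clique-lower K
  ... | inj₂ K′ = ≤-trans (clique-bound j K′) (n≤1+n _)
  ... | inj₁ (c , d , c∈ , d∈ , cd) = ≤-trans (length-∖ c uniq) (s≤s (≤-trans (length-∖ d (Unique-∖ c uniq))
          (s≤s (common-bound cd (Unique-∖ d (Unique-∖ c uniq)) (clique-rest K c∈ d∈ cd)))))

  -- In `E j` the path `u`, `x`, `v` is induced, since `{u , v}` has label `suc j`, and `y` is
  -- adjacent to both of its ends; `cone-complete` then joins `y` to `x`.
  common-clique : ∀ {j} → NoCycle (E j) → ∀ {u v x y} → π G L (suc j) u v →
                  Common j u v x → Common j u v y → x ≢ y → E j x y
  common-clique {j} noCycle {u} {v} {x} {y} uv (ux , vx) (uy , vy) x≢y =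
    E-sym (cone-complete E-sym (E? j) noCycle P y∉p (E-sym uy) (E-sym vy) 1 (s≤s z≤n))
    where
    p : ℕ → V
    p 0 = u
    p 1 = x
    p _ = v
    u≢v = Edge-irrefl (proj₁ uv)
    u≢x = Edge-irrefl (proj₁ ux)
    v≢x = Edge-irrefl (proj₁ vx)
    P : Path (E j) 2 p
    P = record { inj = inj ; step = step ; chord = chord }
      where
      inj : ∀ {i j} → i ≤ 2 → j ≤ 2 → p i ≡ p j → i ≡ j
      inj {0} {0} _ _ _ = refl
      inj {0} {1} _ _ eq = contradiction eq u≢x
      inj {0} {2} _ _ eq = contradiction eq u≢v
      inj {1} {0} _ _ eq = contradiction (≡.sym eq) u≢x
      inj {1} {1} _ _ _ = refl
      inj {1} {2} _ _ eq = contradiction (≡.sym eq) v≢x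
      inj {2} {0} _ _ eq = contradiction (≡.sym eq) u≢v
      inj {2} {1} _ _ eq = contradiction eq v≢x
      inj {2} {2} _ _ _ = refl
      inj {suc (suc (suc _))} (s≤s (s≤s ()))
      inj {_} {suc (suc (suc _))} _ (s≤s (s≤s ()))
      step : ∀ {i} → i < 2 → E j (p i) (p (suc i))
      step {0} _ = ux
      step {1} _ = E-sym vx
      step {suc (suc _)} (s≤s (s≤s ()))
      chord : ∀ {i k} → i < k → k ≤ 2 → E j (p i) (p k) → k ≡ suc i
      chord {0} {1} _ _ _ = refl
      chord {0} {2} _ _ e = contradiction e (π⇒¬E uv)
      chord {1} {2} _ _ _ = refl
      chord {_} {suc (suc (suc _))} _ (s≤s (s≤s ()))
      chord {suc _} {1} (s≤s ())
      chord {suc (suc _)} {2} (s≤s (s≤s ()))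
    y∉p : ∀ {i} → i ≤ 2 → y ≢ p i
    y∉p {0} _ eq = Edge-irrefl (proj₁ uy) (≡.sym eq)
    y∉p {1} _ eq = x≢y (≡.sym eq)
    y∉p {suc (suc _)} _ eq = Edge-irrefl (proj₁ vy) (≡.sym eq)

  -- Chordality of every `E j`, adding one edge at a time.

  module _ {j : ℕ} (noCycleⱼ : NoCycle (E j)) {A : V → V → Set} (A-sym : Symmetric A) (A? : Decidable A)
           (E⊆A : ∀ {x y} → E j x y → A x y) (A⊆E : ∀ {x y} → A x y → E (suc j) x y) (noCycleᴬ : NoCycle A) where

    -- Every common neighbour of u and v is joined to the whole path, and the count ML3 then
    -- forces all steps of the path into π (suc j).
    closing-edge-⊥ : ∀ {u v m p} → π G L (suc j) u v → 3 ≤ m → Path A m p → p m ≡ u → p 0 ≡ v → ⊥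
    closing-edge-⊥ {m = m@(suc (suc (suc _)))} {p} uv (s≤s (s≤s (s≤s z≤n))) P refl refl
      with ns , uniq , len , sound , _ ← common-neighbours uv =
      π-acyclic {p = p} inj π-step uv
      where
      open Path P
      w∉p : ∀ {w} → w ∈ ns → ∀ {i} → i ≤ m → w ≢ p i
      w∉p w∈ {zero} _ refl = Edge-irrefl (proj₁ (proj₂ (sound w∈))) refl
      -- A common neighbour on the path would have index 1, being adjacent to `p 0`; its adjacency
      -- to `p m` would then force `m` to be 2.
      w∉p w∈ {suc i} i≤m refl with chord (s≤s z≤n) i≤m (E⊆A (proj₂ (sound w∈)))
      ... | refl with () ← chord (s≤s (s≤s z≤n)) ≤-refl (A-sym (E⊆A (proj₁ (sound w∈))))
      joined : ∀ {w} → w ∈ ns → ∀ {i} → i ≤ m → A w (p i)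
      joined w∈ {i} = cone-complete A-sym A? noCycleᴬ P (w∉p w∈)
        (A-sym (E⊆A (proj₂ (sound w∈)))) (A-sym (E⊆A (proj₁ (sound w∈)))) i
      joined-inner : ∀ {w} → w ∈ ns → ∀ {i} → suc i < m → E j w (p (suc i))
      joined-inner {w} w∈ {i} i<m with E-suc⁻ (A⊆E (joined w∈ (<⇒≤ i<m)))
      ... | inj₁ e  = e
      -- With label `suc j`, the edge from `w` to `p (suc i)` would have at least `suc j` common
      -- neighbours in `E j`: the two path neighbours of `p (suc i)` and the elements of `ns` other
      -- than `w`.
      ... | inj₂ wp = contradiction (≤-trans (s≤s (≤-trans (≤-reflexive (≡.sym len)) (length-∖ w uniq)))
                                             (common-bound wp uniq′ sound′)) (<-irrefl refl)
        where
        i≤m : i ≤ m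
        i≤m = ≤-trans (n≤1+n i) (<⇒≤ i<m)
        xs : List V
        xs = p i ∷ p (suc (suc i)) ∷ (ns ∖ w)
        uniq′ : Unique xs
        uniq′ = ((λ eq → <-irrefl (inj i≤m i<m eq) (n≤1+n (suc i)))
                  ∷ All.tabulate (λ y∈ eq → w∉p (proj₁ (∈-∖⁻ y∈)) i≤m (≡.sym eq)))
                ∷ All.tabulate (λ y∈ eq → w∉p (proj₁ (∈-∖⁻ y∈)) i<m (≡.sym eq))
                ∷ Unique-∖ w uniq
        sound′ : ∀ {y} → y ∈ xs → Common j w (p (suc i)) y
        sound′ (here refl)         = absorb wp (A⊆E (joined w∈ i≤m) , A⊆E (A-sym (step (<⇒≤ i<m))))
        sound′ (there (here refl)) = absorb wp (A⊆E (joined w∈ i<m) , A⊆E (step i<m))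
        sound′ (there (there y∈)) with y∈ns , y≢w ← ∈-∖⁻ y∈ =
          absorb wp ( E-suc (common-clique noCycleⱼ uv (sound w∈) (sound y∈ns) (y≢w ∘ ≡.sym))
                    , E-sym (A⊆E (joined y∈ns (<⇒≤ i<m))))
      joined-E : ∀ {w} → w ∈ ns → ∀ {i} → i ≤ m → E j w (p i)
      joined-E w∈ {zero}  _   = E-sym (proj₂ (sound w∈))
      joined-E w∈ {suc i} i≤m with m≤n⇒m<n∨m≡n i≤m
      ... | inj₁ i<m  = joined-inner w∈ i<m
      ... | inj₂ refl = E-sym (proj₁ (sound w∈))
      π-step : ∀ {i} → i < m → π G L (suc j) (p i) (p (suc i))
      π-step {i} i<m with E-suc⁻ (A⊆E (step i<m))
      ... | inj₂ e = e
      -- A step of smaller label would form with `ns` a clique of `2 + j` vertices in `E j`.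
      ... | inj₁ e = contradiction (≤-trans (s≤s (s≤s (≤-reflexive (≡.sym len)))) (clique-bound j K₂)) (<-irrefl refl)
        where
        K₀ : Clique (E j) ns
        K₀ = uniq , λ x∈ y∈ → common-clique noCycleⱼ uv (sound x∈) (sound y∈)
        K₁ : Clique (E j) (p (suc i) ∷ ns)
        K₁ = Clique-∷ E-sym K₀ (λ q∈ → w∉p q∈ i<m refl) (λ w∈ → E-sym (joined-E w∈ i<m))
        K₂ : Clique (E j) (p i ∷ p (suc i) ∷ ns)
        K₂ = Clique-∷ E-sym K₁
          (λ { (here eq) → Edge-irrefl (proj₁ e) eq ; (there q∈) → w∉p q∈ (<⇒≤ i<m) refl })
          (λ { (here refl) → e ; (there w∈) → E-sym (joined-E w∈ (<⇒≤ i<m)) })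

    -- A long induced cycle of `B` with all its edges in `A` is one of `A`. Otherwise it is rotated
    -- until the new edge closes it, and the rest is an induced path of `A` as in `closing-edge-⊥`.
    add-edge-NoCycle : ∀ {u v} → π G L (suc j) u v → ¬ A u v → {B : V → V → Set} → Symmetric B →
      (∀ {x y} → A x y → B x y) → (∀ {x y} → B x y → A x y ⊎ (x ≡ u × y ≡ v) ⊎ (x ≡ v × y ≡ u)) → NoCycle B
    add-edge-NoCycle {u} {v} uv ¬Auv {B} B-sym A⊆B B⊆A+uv {m} {p} 3≤m C = result
      where
      closed-⊥ : ∀ {x y q} → π G L (suc j) x y → ¬ A x y →
        (∀ {a b} → B a b → A a b ⊎ (a ≡ x × b ≡ y) ⊎ (a ≡ y × b ≡ x)) → Cycle B m q → q m ≡ x → q 0 ≡ y → ⊥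
      closed-⊥ {q = q} xy ¬Axy B⊆ D refl refl = closing-edge-⊥ xy 3≤m record { inj = inj ; step = step′ ; chord = chord′ } refl refl
        where
        open Cycle D
        step′ : ∀ {i} → i < m → A (q i) (q (suc i))
        step′ i<m with B⊆ (step i<m)
        -- The new edge joins `q m` to `q 0`, so by injectivity of `q` and `3 ≤ m` it is not a step
        -- as well.
        ... | inj₁ a = a
        ... | inj₂ (inj₁ (eq , _)) = contradiction i<m (<-irrefl (inj (<⇒≤ i<m) ≤-refl eq))
        ... | inj₂ (inj₂ (eq , eq′)) with refl ← inj (<⇒≤ i<m) z≤n eq with refl ← inj i<m ≤-refl eq′ =
          contradiction 3≤m λ { (s≤s ()) }
        chord′ : ∀ {i k} → i < k → k ≤ m → A (q i) (q k) → k ≡ suc i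
        chord′ i<k k≤m a with chord i<k k≤m (A⊆B a)
        ... | inj₁ eq            = eq
        ... | inj₂ (refl , refl) = contradiction (A-sym a) ¬Axy
      new-edge-⊥ : ∀ {q} → Cycle B m q → ¬ A (q m) (q 0) → ⊥
      new-edge-⊥ D ¬a with B⊆A+uv (Cycle.close D)
      ... | inj₁ a                  = ¬a a
      ... | inj₂ (inj₁ (eq , eq′)) = closed-⊥ uv ¬Auv B⊆A+uv D eq eq′
      ... | inj₂ (inj₂ (eq , eq′)) = closed-⊥ (π-sym uv) (¬Auv ∘ A-sym)
          ([ inj₁ , [ inj₂ ∘ inj₂ , inj₂ ∘ inj₁ ]′ ]′ ∘ B⊆A+uv) D eq eq′
      result : ⊥
      result with ℕ.anyUpTo? (λ i → ¬? (A? (p i) (p (suc i)))) m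
      ... | yes (i , i<m , ¬a) with q , D , eq , eq′ ← rotate-to B-sym (≤-trans (s≤s z≤n) 3≤m) C i i<m =
        new-edge-⊥ D (subst₂ (λ x y → ¬ A x y) (≡.sym eq) (≡.sym eq′) ¬a)
      ... | no ¬∃ with A? (p m) (p 0)
      ... | no ¬a = new-edge-⊥ C ¬a
      ... | yes a = noCycleᴬ 3≤m record
        { inj   = inj
        ; step  = λ {i} i<m → decidable-stable (A? (p i) (p (suc i))) λ ¬a → ¬∃ (i , i<m , ¬a)
        ; close = a
        ; chord = λ i<k k≤m → chord i<k k≤m ∘ A⊆B }
        where open Cycle C

  -- The conjunct `E (suc j) x y` filters `S`, so that `S` may be any list of pairs: the empty list
  -- gives `E j`, the list of all pairs gives `E (suc j)`.
  Layer : ℕ → List (V × V) → V → V → Set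
  Layer j S x y = E (suc j) x y × (lab x y ≤ j ⊎ (x , y) ∈ S ⊎ (y , x) ∈ S)

  Layer-sym : ∀ {j S} → Symmetric (Layer j S)
  Layer-sym {j} {S} {x} {y} (e , inj₁ l)        = E-sym e , inj₁ (subst (_≤ j) (lab-sym x y (proj₁ e)) l)
  Layer-sym                 (e , inj₂ (inj₁ s)) = E-sym e , inj₂ (inj₂ s)
  Layer-sym                 (e , inj₂ (inj₂ s)) = E-sym e , inj₂ (inj₁ s)

  Layer? : ∀ j S → Decidable (Layer j S)
  Layer? j S x y = E? (suc j) x y ×-dec ((lab x y ≤? j) ⊎-dec (((x , y) ∈? S) ⊎-dec ((y , x) ∈? S)))
    where open DecMembership (≡-dec _≟_ _≟_) using (_∈?_)

  Layer-∷ : ∀ {j S s x y} → Layer j S x y → Layer j (s ∷ S) x y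
  Layer-∷ (e , inj₁ l)        = e , inj₁ l
  Layer-∷ (e , inj₂ (inj₁ s)) = e , inj₂ (inj₁ (there s))
  Layer-∷ (e , inj₂ (inj₂ s)) = e , inj₂ (inj₂ (there s))

  Layer-∷⁻ : ∀ {j S u v x y} → Layer j ((u , v) ∷ S) x y → Layer j S x y ⊎ (x ≡ u × y ≡ v) ⊎ (x ≡ v × y ≡ u)
  Layer-∷⁻ (e , inj₁ l)                  = inj₁ (e , inj₁ l)
  Layer-∷⁻ (e , inj₂ (inj₁ (here refl))) = inj₂ (inj₁ (refl , refl))
  Layer-∷⁻ (e , inj₂ (inj₁ (there s)))   = inj₁ (e , inj₂ (inj₁ s))
  Layer-∷⁻ (e , inj₂ (inj₂ (here refl))) = inj₂ (inj₂ (refl , refl))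
  Layer-∷⁻ (e , inj₂ (inj₂ (there s)))   = inj₁ (e , inj₂ (inj₂ s))

  -- A pair that is already present or is not in `E (suc j)` leaves the graph unchanged; any other
  -- pair is an edge of label `suc j`, handled by `add-edge-NoCycle`.
  Layer-NoCycle : ∀ {j} → NoCycle (E j) → ∀ S → NoCycle (Layer j S)
  Layer-NoCycle noCycle [] = NoCycle-resp (λ (e , l) → E-suc (e , l) , inj₁ l) (λ { (e , inj₁ l) → proj₁ e , l ; (_ , inj₂ (inj₁ ())) ; (_ , inj₂ (inj₂ ())) }) noCycle
  Layer-NoCycle {j} noCycle ((u , v) ∷ S) with Layer? j S u v | E? (suc j) u v
  ... | yes a | _ = NoCycle-resp Layer-∷ back (Layer-NoCycle noCycle S)
    where
    back : ∀ {x y} → Layer j ((u , v) ∷ S) x y → Layer j S x y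
    back b with Layer-∷⁻ b
    ... | inj₁ b′                   = b′
    ... | inj₂ (inj₁ (refl , refl)) = a
    ... | inj₂ (inj₂ (refl , refl)) = Layer-sym a
  ... | no _ | no ¬e = NoCycle-resp Layer-∷ back (Layer-NoCycle noCycle S)
    where
    back : ∀ {x y} → Layer j ((u , v) ∷ S) x y → Layer j S x y
    back b with Layer-∷⁻ b
    ... | inj₁ b′                   = b′
    ... | inj₂ (inj₁ (refl , refl)) = contradiction (proj₁ b) ¬e
    ... | inj₂ (inj₂ (refl , refl)) = contradiction (E-sym (proj₁ b)) ¬e
  ... | no ¬a | yes e with E-suc⁻ e
  ...   | inj₁ (e′ , l) = contradiction (e , inj₁ l) ¬a
  ...   | inj₂ uv = add-edge-NoCycle noCycle Layer-sym (Layer? j S) (λ (e , l) → E-suc (e , l) , inj₁ l) proj₁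
                      (Layer-NoCycle noCycle S) uv ¬a Layer-sym Layer-∷ Layer-∷⁻

  E-NoCycle : ∀ j → NoCycle (E j)
  E-NoCycle zero    _ C = E₀-empty (Cycle.close C)
  E-NoCycle (suc j) = NoCycle-resp proj₁
    (λ e → e , inj₂ (inj₁ (∈-cartesianProduct⁺ (∈-allFin _) (∈-allFin _))))
    (Layer-NoCycle (E-NoCycle j) (cartesianProduct (allFin (n G)) (allFin (n G))))

  -- Principal cliques.

  Inside : V → V → V → Set
  Inside u v w = Edge G u v × (Edge G u w × lab u w < lab u v) × (Edge G v w × lab v w < lab u v)

  Principal : V → V → V → Set
  Principal u v w = w ≡ u ⊎ w ≡ v ⊎ Inside u v w

  label-suc : ∀ {u v} → Edge G u v → ∃ λ j → π G L (suc j) u v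
  label-suc {u} {v} e with lab u v | lab-pos u v e
  ... | suc j | _ = j , e , refl

  -- `Inside` describes the vertices that `ML3` counts, with the label of the edge in place of a
  -- level. This makes edges of different labels comparable.
  Inside⇒Common : ∀ {j u v w} → π G L (suc j) u v → Inside u v w → Common j u v w
  Inside⇒Common (_ , eq) (_ , (uw , l) , (vw , l′)) =
    (uw , s≤s⁻¹ (ℕ.<-≤-trans l (≤-reflexive eq))) , (vw , s≤s⁻¹ (ℕ.<-≤-trans l′ (≤-reflexive eq)))

  Common⇒Inside : ∀ {j u v w} → π G L (suc j) u v → Common j u v w → Inside u v w
  Common⇒Inside (uv , eq) ((uw , l) , (vw , l′)) =
    uv , (uw , ≤-trans (s≤s l) (≤-reflexive (≡.sym eq))) , (vw , ≤-trans (s≤s l′) (≤-reflexive (≡.sym eq)))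

  Inside-sym : ∀ {u v w} → Inside u v w → Inside v u w
  Inside-sym {u} {v} {w} (uv , (uw , l) , (vw , l′)) =
    Edge-sym uv , (vw , subst (lab v w <_) (lab-sym u v uv) l′) , (uw , subst (lab u w <_) (lab-sym u v uv) l)

  Inside-clique : ∀ {u v x y} → Inside u v x → Inside u v y → x ≢ y → Edge G x y × lab x y < lab u v
  Inside-clique x∈ y∈ x≢y
    with j , uv ← label-suc (proj₁ x∈)
    with xy , l ← common-clique (E-NoCycle j) uv (Inside⇒Common uv x∈) (Inside⇒Common uv y∈) x≢y =
    xy , ≤-trans (s≤s l) (≤-reflexive (≡.sym (proj₂ uv)))

  -- Weak inequalities suffice, as `absorb` makes them strict.
  maximal⇒Inside : ∀ {x y z} → Edge G x y → Edge G x z → Edge G y z → lab x z ≤ lab x y → lab y z ≤ lab x y → Inside x y z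
  maximal⇒Inside {x} {y} {z} xy xz yz l l′ with j , p ← label-suc xy =
    Common⇒Inside p (absorb p ((xz , subst (lab x z ≤_) (proj₂ p) l) , (yz , subst (lab y z ≤_) (proj₂ p) l′)))

  triangle-max : ∀ {x y z} → Edge G x y → Edge G x z → Edge G y z → Inside x y z ⊎ Inside y z x ⊎ Inside x z y
  triangle-max {x} {y} {z} xy xz yz with ℕ.≤-total (lab x z) (lab x y) | ℕ.≤-total (lab y z) (lab x y) | ℕ.≤-total (lab x z) (lab y z)
  ... | inj₁ a | inj₁ b | _      = inj₁ (maximal⇒Inside xy xz yz a b)
  ... | _      | inj₂ b | inj₁ c = inj₂ (inj₁ (maximal⇒Inside yz (Edge-sym xy) (Edge-sym xz)
        (subst (_≤ lab y z) (lab-sym x y xy) b) (subst (_≤ lab y z) (lab-sym x z xz) c)))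
  ... | inj₂ a | _      | inj₂ c = inj₂ (inj₂ (maximal⇒Inside xz xy (Edge-sym yz) a (subst (_≤ lab x z) (lab-sym y z yz) c)))
  ... | inj₁ a | inj₂ b | inj₂ c = inj₂ (inj₁ (maximal⇒Inside yz (Edge-sym xy) (Edge-sym xz)
        (subst (_≤ lab y z) (lab-sym x y xy) b) (subst (_≤ lab y z) (lab-sym x z xz) (≤-trans a b))))
  ... | inj₂ a | inj₁ b | inj₁ c = inj₂ (inj₂ (maximal⇒Inside xz xy (Edge-sym yz) a
        (subst (_≤ lab x z) (lab-sym y z yz) (≤-trans b a))))

  -- `{c , d}` is the only edge of label `suc j` here: the other vertices lie in `Common j c d`, and
  -- by `common-clique` the edges among them also lie in `E j`.
  clique-drop : ∀ {j xs c d} → Clique (E (suc j)) xs → c ∈ xs → d ∈ xs → π G L (suc j) c d → Clique (E j) (xs ∖ c)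
  clique-drop {j} {xs} {c} {d} K@(uniq , _) c∈ d∈ cd = Unique-∖ c uniq , adj′
    where
    adj′ : ∀ {x y} → x ∈ xs ∖ c → y ∈ xs ∖ c → x ≢ y → E j x y
    adj′ {x} {y} x∈ y∈ x≢y with x ≟ d | y ≟ d
    ... | yes refl | yes refl = contradiction refl x≢y
    ... | yes refl | no y≢d   = proj₂ (clique-rest K c∈ d∈ cd (∈-∖⁺ y∈ y≢d))
    ... | no x≢d   | yes refl = E-sym (proj₂ (clique-rest K c∈ d∈ cd (∈-∖⁺ x∈ x≢d)))
    ... | no x≢d   | no y≢d   = common-clique (E-NoCycle j) cd
          (clique-rest K c∈ d∈ cd (∈-∖⁺ x∈ x≢d)) (clique-rest K c∈ d∈ cd (∈-∖⁺ y∈ y≢d)) x≢y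

  -- Deleting an end of the edge of maximal label from a clique attaining clique-bound leaves a
  -- clique attaining it one level lower, so one can descend until {a , b} has maximal label.
  tight-clique-closed : ∀ j {xs} → Clique (E j) xs → suc j ≤ length xs →
    ∀ {a b z} → a ∈ xs → b ∈ xs → a ≢ b → Inside a b z → z ∈ xs
  tight-clique-closed zero (_ , adj) _ a∈ b∈ a≢b _ = ⊥-elim (E₀-empty (adj a∈ b∈ a≢b))
  tight-clique-closed (suc j) {xs} K@(uniq , _) len {a} {b} {z} a∈ b∈ a≢b ins with clique-lower K
  ... | inj₂ K′ = contradiction (≤-trans len (clique-bound j K′)) (<-irrefl refl)
  ... | inj₁ (c , d , c∈ , d∈ , cd) = by-cases
    where
    open DecMembership _≟_ using (_∈?_)
    descend : ∀ {c d} → c ∈ xs → d ∈ xs → π G L (suc j) c d → a ≢ c → b ≢ c → z ∈ xs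
    descend {c} c∈ d∈ cd a≢c b≢c = proj₁ (∈-∖⁻ (tight-clique-closed j (clique-drop K c∈ d∈ cd)
      (s≤s⁻¹ (≤-trans len (length-∖ c uniq))) (∈-∖⁺ a∈ a≢c) (∈-∖⁺ b∈ b≢c) a≢b ins))
    top : π G L (suc j) a b → z ∈ xs
    top ab with z ∈? xs
    ... | yes z∈ = z∈
    -- Besides `a` and `b` the clique has at least `j` vertices, so `z` would bring the common
    -- neighbours to `suc j`.
    ... | no  z∉ = contradiction (≤-trans (s≤s (s≤s⁻¹ (s≤s⁻¹ (≤-trans len
                     (≤-trans (length-∖ a uniq) (s≤s (length-∖ b (Unique-∖ a uniq))))))))
                     (common-bound ab uniq′ sound)) (<-irrefl refl)
      where
      uniq′ : Unique (z ∷ (xs ∖ a ∖ b))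
      uniq′ = All.tabulate (λ y∈ z≡y → z∉ (subst (_∈ xs) (≡.sym z≡y) (proj₁ (∈-∖⁻ (proj₁ (∈-∖⁻ y∈))))))
              ∷ Unique-∖ b (Unique-∖ a uniq)
      sound : ∀ {y} → y ∈ z ∷ (xs ∖ a ∖ b) → Common j a b y
      sound (here refl) = Inside⇒Common ab ins
      sound (there y∈)  = clique-rest K a∈ b∈ ab y∈
    by-cases : z ∈ xs
    -- Either one of `c`, `d` is neither `a` nor `b` and can be deleted, or `{a , b}` is the top
    -- edge itself.
    by-cases with a ≟ c | b ≟ c | a ≟ d | b ≟ d
    ... | no a≢c   | no b≢c   | _        | _        = descend c∈ d∈ cd a≢c b≢c
    ... | _        | _        | no a≢d   | no b≢d   = descend d∈ c∈ (π-sym cd) a≢d b≢d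
    ... | yes refl | yes refl | _        | _        = contradiction refl a≢b
    ... | yes refl | _        | _        | yes refl = top cd
    ... | _        | yes refl | yes refl | _        = top (π-sym cd)
    ... | yes refl | _        | yes refl | _        = contradiction refl (Edge-irrefl (proj₁ cd))
    ... | _        | yes refl | _        | yes refl = contradiction refl (Edge-irrefl (proj₁ cd))

  -- The size attains `clique-bound` in `E (suc j)`, which makes `tight-clique-closed` applicable.
  principal-clique : ∀ {j u v} → π G L (suc j) u v → ∃ λ xs → Clique (E (suc j)) xs × length xs ≡ suc (suc j)
    × (∀ {w} → w ∈ xs → Principal u v w) × (∀ {w} → Principal u v w → w ∈ xs)
  principal-clique {j} {u} {v} uv with ns , uniq , len , sound , complete ← common-neighbours uv =
    u ∷ v ∷ ns , K , cong (suc ∘ suc) len , sound′ , complete′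
    where
    K : Clique (E (suc j)) (u ∷ v ∷ ns)
    K = Clique-∷ E-sym
      (Clique-∷ E-sym (uniq , λ x∈ y∈ x≢y → E-suc (common-clique (E-NoCycle j) uv (sound x∈) (sound y∈) x≢y))
        (λ v∈ → Edge-irrefl (proj₁ (proj₂ (sound v∈))) refl) (E-suc ∘ proj₂ ∘ sound))
      (λ { (here eq) → Edge-irrefl (proj₁ uv) eq ; (there u∈) → Edge-irrefl (proj₁ (proj₁ (sound u∈))) refl })
      (λ { (here refl) → proj₁ uv , ≤-reflexive (proj₂ uv) ; (there w∈) → E-suc (proj₁ (sound w∈)) })
    sound′ : ∀ {w} → w ∈ u ∷ v ∷ ns → Principal u v w
    sound′ (here eq)          = inj₁ eq
    sound′ (there (here eq))  = inj₂ (inj₁ eq)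
    sound′ (there (there w∈)) = inj₂ (inj₂ (Common⇒Inside uv (sound w∈)))
    complete′ : ∀ {w} → Principal u v w → w ∈ u ∷ v ∷ ns
    complete′ (inj₁ eq)         = here eq
    complete′ (inj₂ (inj₁ eq))  = there (here eq)
    complete′ (inj₂ (inj₂ ins)) = there (there (complete (Inside⇒Common uv ins)))

  Principal-closed : ∀ {u v a b z} → Edge G u v → Principal u v a → Principal u v b → a ≢ b → Inside a b z → Principal u v z
  Principal-closed e a∈ b∈ a≢b ins
    with j , uv ← label-suc e
    with xs , K , len , sound , complete ← principal-clique uv =
    sound (tight-clique-closed (suc j) K (≤-reflexive (≡.sym len)) (complete a∈) (complete b∈) a≢b ins)

  Principal-adjacent : ∀ {u v a b} → Edge G u v → Principal u v a → Principal u v b → a ≢ b → Edge G a b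
  Principal-adjacent e a∈ b∈ a≢b
    with j , uv ← label-suc e
    with xs , (_ , adj) , _ , _ , complete ← principal-clique uv = proj₁ (adj (complete a∈) (complete b∈) a≢b)

  -- The principal clique of the maximal edge of the triangle `x`, `y`, `w` contains the triangle,
  -- hence also the principal clique of `{x , y}` and with it `z`.
  Inside-adjacent : ∀ {x y z w} → Inside x y z → Edge G x w → Edge G y w → w ≢ z → Edge G w z
  Inside-adjacent {x} {y} {z} {w} ins@(xy , _) xw yw w≢z with triangle-max xy xw yw
  ... | inj₁ w∈         = proj₁ (Inside-clique w∈ ins w≢z)
  ... | inj₂ (inj₁ x∈) = Principal-adjacent yw (inj₂ (inj₁ refl))
          (Principal-closed yw (inj₂ (inj₂ x∈)) (inj₁ refl) (Edge-irrefl xy) ins) w≢z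
  ... | inj₂ (inj₂ y∈) = Principal-adjacent xw (inj₂ (inj₁ refl))
          (Principal-closed xw (inj₁ refl) (inj₂ (inj₂ y∈)) (Edge-irrefl xy) ins) w≢z

  -- For `y` distinct from `p` and `q`, the principal clique of the maximal edge of the triangle
  -- `p`, `q`, `y` would contain `x` and `y`, giving `{x , y}` a smaller label than that edge,
  -- against the bounds. The hypotheses on `{p , y}` and `{q , y}` are conditional because `y` may
  -- coincide with `p` or `q`.
  maximal-end-not-Inside : ∀ {x y p q} → Edge G x y → (y ≢ p → Edge G p y) → (y ≢ q → Edge G q y) →
    lab p q ≤ lab x y → (y ≢ p → lab p y ≤ lab x y) → (y ≢ q → lab q y ≤ lab x y) → ¬ Inside p q x
  maximal-end-not-Inside {x} {y} {p} {q} xy py qy pq≤ py≤ qy≤ ins@(pq , (px , px<) , (qx , qx<)) with y ≟ p | y ≟ q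
  ... | yes refl | _        = <⇒≱ px< (≤-trans pq≤ (≤-reflexive (lab-sym x y xy)))
  ... | no _     | yes refl = <⇒≱ qx< (≤-trans pq≤ (≤-reflexive (lab-sym x y xy)))
  ... | no y≢p   | no y≢q with triangle-max pq (py y≢p) (qy y≢q)
  ...   | inj₁ y∈ = <⇒≱ (proj₂ (Inside-clique ins y∈ (Edge-irrefl xy))) pq≤
  ...   | inj₂ (inj₁ p∈) = outside (Principal-closed (qy y≢q) (inj₁ refl) (inj₂ (inj₂ p∈)) (Edge-irrefl (Edge-sym pq)) (Inside-sym ins))
    where
    outside : ¬ Principal q y x
    outside (inj₁ eq)        = Edge-irrefl qx (≡.sym eq)
    outside (inj₂ (inj₁ eq)) = Edge-irrefl xy eq
    outside (inj₂ (inj₂ (_ , _ , (_ , l)))) = <⇒≱ l (≤-trans (qy≤ y≢q) (≤-reflexive (lab-sym x y xy)))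
  ...   | inj₂ (inj₂ q∈) = outside (Principal-closed (py y≢p) (inj₁ refl) (inj₂ (inj₂ q∈)) (Edge-irrefl pq) ins)
    where
    outside : ¬ Principal p y x
    outside (inj₁ eq)        = Edge-irrefl px (≡.sym eq)
    outside (inj₂ (inj₁ eq)) = Edge-irrefl xy eq
    outside (inj₂ (inj₂ (_ , _ , (_ , l)))) = <⇒≱ l (≤-trans (py≤ y≢p) (≤-reflexive (lab-sym x y xy)))

-- Cyclic indices, and the exclusion of induced cycles and suns.

max-pair : ∀ {m} (f : Fin (suc m) → Fin (suc m) → ℕ) → ∃ λ a → ∃ λ b → ∀ i j → f i j ≤ f a b
max-pair {m} f = proj₁ best , proj₂ best , λ i j →
  All.lookup (f[xs]≤f[argmax] {f = uncurry f} (Fin.zero , Fin.zero) pairs) (∈-cartesianProduct⁺ (∈-allFin i) (∈-allFin j))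
  where
  pairs = cartesianProduct (allFin (suc m)) (allFin (suc m))
  best  = argmax (uncurry f) (Fin.zero , Fin.zero) pairs

next-surjective : ∀ {m} (a : Fin (suc m)) → ∃ λ i → a ≡ next i
next-surjective {m} Fin.zero    = fromℕ m , toℕ-injective (≡.sym (next-last (fromℕ m) (toℕ-fromℕ m)))
next-surjective {m} (Fin.suc a) = inject₁ a , toℕ-injective
  (≡.sym (trans (next-< (inject₁ a) (subst (_< m) (≡.sym (toℕ-inject₁ a)) (toℕ<n a))) (cong suc (toℕ-inject₁ a))))

next-≢ : ∀ {m} → 1 ≤ m → (i : Fin (suc m)) → i ≢ next i
next-≢ 1≤m i eq with m≤n⇒m<n∨m≡n (s≤s⁻¹ (toℕ<n i))
... | inj₁ i<m = ℕ.1+n≢n (≡.sym (trans (cong toℕ eq) (next-< i i<m)))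
... | inj₂ i≡m = <⇒≱ 1≤m (≤-reflexive (trans (≡.sym i≡m) (trans (cong toℕ eq) (next-last i i≡m))))

next-next-≢ : ∀ {m} → 2 ≤ m → (i : Fin (suc m)) → i ≢ next (next i)
next-next-≢ {m} 2≤m i eq with m≤n⇒m<n∨m≡n (s≤s⁻¹ (toℕ<n i))
... | inj₂ i≡m = <⇒≱ 2≤m (≤-reflexive (trans (≡.sym i≡m) (trans (cong toℕ eq)
      (trans (next-< (next i) (subst (_< m) (≡.sym (next-last i i≡m)) (≤-trans (s≤s z≤n) 2≤m))) (cong suc (next-last i i≡m))))))
... | inj₁ i<m with m≤n⇒m<n∨m≡n (s≤s⁻¹ (toℕ<n (next i)))
...   | inj₁ ni<m = ℕ.m≢1+n+m (toℕ i) {1} (trans (cong toℕ eq) (trans (next-< (next i) ni<m) (cong suc (next-< i i<m))))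
...   | inj₂ ni≡m = <⇒≱ 2≤m (≤-reflexive (trans (≡.sym ni≡m) (trans (next-< i i<m)
      (cong suc (trans (cong toℕ eq) (next-last (next i) ni≡m))))))

induced-Cycle : ∀ {N k} {R : Fin N → Fin N → Set} (φ : Fin (suc k) → Fin N) → (∀ {x y} → φ x ≡ φ y → x ≡ y) →
  (∀ x y → R (φ x) (φ y) → CycleAdj k x y) → (∀ x y → CycleAdj k x y → R (φ x) (φ y)) → Cycle R k (λ i → φ (i mod suc k))
induced-Cycle {k = k} {R} φ φ-inj only all = record { inj = inj ; step = step ; close = close ; chord = chord }
  where
  toℕ-mod : ∀ {i} → i ≤ k → toℕ (i mod suc k) ≡ i
  toℕ-mod i≤k = trans (toℕ-fromℕ< _) (m<n⇒m%n≡m (s≤s i≤k))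
  inj : ∀ {i j} → i ≤ k → j ≤ k → φ (i mod suc k) ≡ φ (j mod suc k) → i ≡ j
  inj i≤k j≤k eq = trans (≡.sym (toℕ-mod i≤k)) (trans (cong toℕ (φ-inj eq)) (toℕ-mod j≤k))
  mod-next : ∀ {i} → i ≤ k → next (i mod suc k) ≡ suc i mod suc k
  mod-next i≤k = cong (λ t → suc t mod suc k) (toℕ-mod i≤k)
  step : ∀ {i} → i < k → R (φ (i mod suc k)) (φ (suc i mod suc k))
  step i<k = all _ _ (inj₁ (≡.sym (mod-next (<⇒≤ i<k))))
  close : R (φ (k mod suc k)) (φ (0 mod suc k))
  close = all _ _ (inj₁ (toℕ-injective (≡.sym (next-last (k mod suc k) (toℕ-mod ≤-refl)))))
  chord : ∀ {i j} → i < j → j ≤ k → R (φ (i mod suc k)) (φ (j mod suc k)) → j ≡ suc i ⊎ (i ≡ 0 × j ≡ k)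
  chord {i} {j} i<j j≤k r with only _ _ r
  ... | inj₁ eq = inj₁ (trans (≡.sym (toℕ-mod j≤k)) (trans (cong toℕ (trans eq (mod-next (<⇒≤ i<k)))) (toℕ-mod i<k)))
    where
    i<k : i < k
    i<k = ≤-trans i<j j≤k
  ... | inj₂ eq with m≤n⇒m<n∨m≡n j≤k
  ...   | inj₂ refl = inj₂ (trans (≡.sym (toℕ-mod (<⇒≤ i<j))) (trans (cong toℕ eq) (next-last (j mod suc k) (toℕ-mod ≤-refl))) , refl)
  ...   | inj₁ j<k  = contradiction
          (trans (≡.sym (toℕ-mod (≤-trans (<⇒≤ i<j) j≤k))) (trans (cong toℕ (trans eq (mod-next j≤k))) (toℕ-mod j<k)))
          (λ i≡1+j → <⇒≱ i<j (≤-trans (n≤1+n j) (≤-reflexive (≡.sym i≡1+j))))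

-- An induced cycle of `G` is one of `E j` once `j` bounds its labels. The maximum runs over all
-- pairs, non-edges included, since only an upper bound is wanted.
MAT⇒Chordal : (G : Graph) → HasMATLabeling G → Chordal G
MAT⇒Chordal G (L , mat) k 3≤k (φ , φ-inj , iff) = refute (max-pair λ i j → lab (φ i) (φ j))
  where
  open MAT G L mat
  open Labeling L
  refute : ¬ ∃ λ a → ∃ λ b → ∀ i j → lab (φ i) (φ j) ≤ lab (φ a) (φ b)
  refute (a , b , bound) = E-NoCycle (lab (φ a) (φ b)) 3≤k (induced-Cycle φ φ-inj
    (λ x y e → Equivalence.to (iff x y) (proj₁ e))
    (λ x y c → Equivalence.from (iff x y) c , bound x y))

-- For an edge {x , y} of maximal label in the central clique, consider x with its two cyclic
-- neighbours p and q. The maximal edge of this triangle is not {p , q}; if it is {x , p} or {x , q},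
-- the ray attached to that edge is adjacent to the third vertex.
MAT⇒sun-free : (G : Graph) → HasMATLabeling G → ∀ k → 2 ≤ k →
               ¬ HasInducedCopy G (Fin (suc k) ⊎ Fin (suc k)) (SunAdj k)
MAT⇒sun-free G (L , mat) k 2≤k (φ , φ-inj , iff) = refute (max-pair weight)
  where
  open MAT G L mat
  open Labeling L
  u w : Fin (suc k) → V
  u i = φ (inj₁ i)
  w i = φ (inj₂ i)
  u-edge : ∀ {i j} → i ≢ j → Edge G (u i) (u j)
  u-edge = Equivalence.from (iff _ _)
  1≤k : 1 ≤ k
  1≤k = ≤-trans (s≤s z≤n) 2≤k
  ray-⊥ : ∀ i j → j ≢ i → j ≢ next i → ¬ Inside (u i) (u (next i)) (u j)
  ray-⊥ i j j≢i j≢ni ins with Equivalence.to (iff (inj₂ i) (inj₁ j)) (Inside-adjacent ins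
    (Equivalence.from (iff (inj₁ i) (inj₂ i)) (inj₁ refl))
    (Equivalence.from (iff (inj₁ (next i)) (inj₂ i)) (inj₂ refl))
    (λ eq → contradiction (φ-inj eq) λ ()))
  ... | inj₁ eq = j≢i eq
  ... | inj₂ eq = j≢ni eq
  -- Zero on the diagonal, where `lab` is unconstrained, and positive elsewhere, so that the maximum
  -- is attained at distinct indices.
  weight : Fin (suc k) → Fin (suc k) → ℕ
  weight i j with i ≟ j
  ... | yes _ = 0
  ... | no  _ = lab (u i) (u j)
  weight-≢ : ∀ {i j} → i ≢ j → weight i j ≡ lab (u i) (u j)
  weight-≢ {i} {j} i≢j with i ≟ j
  ... | yes eq = contradiction eq i≢j
  ... | no  _  = refl
  weight-refl : ∀ i → weight i i ≡ 0
  weight-refl i with i ≟ i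
  ... | yes _  = refl
  ... | no i≢i = contradiction refl i≢i
  refute : ¬ ∃ λ a → ∃ λ b → ∀ i j → weight i j ≤ weight a b
  -- Writing `a` as `next i` provides its cyclic predecessor `i`; with the successor `q` this gives
  -- three distinct indices because `2 ≤ k`.
  refute (a , b , bound) with i , refl ← next-surjective a = by-triangle
    where
    x = next i
    q = next x
    i≢x : i ≢ x
    i≢x = next-≢ 1≤k i
    x≢q : x ≢ q
    x≢q = next-≢ 1≤k x
    i≢q : i ≢ q
    i≢q = next-next-≢ 2≤k i
    x≢b : x ≢ b
    x≢b eq = <⇒≱ (lab-pos (u i) (u x) (u-edge i≢x)) (≤-trans (≤-reflexive (≡.sym (weight-≢ i≢x)))
      (≤-trans (bound i x) (≤-reflexive (trans (cong (weight x) (≡.sym eq)) (weight-refl x)))))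
    maximal : ∀ {c d} → c ≢ d → lab (u c) (u d) ≤ lab (u x) (u b)
    maximal {c} {d} c≢d = subst₂ _≤_ (weight-≢ c≢d) (weight-≢ x≢b) (bound c d)
    distinct : ∀ {c} → u b ≢ u c → c ≢ b
    distinct ub≢uc eq = ub≢uc (cong u (≡.sym eq))
    by-triangle : ⊥
    by-triangle with triangle-max (u-edge i≢q) (u-edge i≢x) (u-edge (x≢q ∘ ≡.sym))
    ... | inj₁ ins = maximal-end-not-Inside (u-edge x≢b) (u-edge ∘ distinct) (u-edge ∘ distinct)
                       (maximal i≢q) (maximal ∘ distinct) (maximal ∘ distinct) ins
    ... | inj₂ (inj₁ ins) = ray-⊥ x i i≢x i≢q (Inside-sym ins)
    ... | inj₂ (inj₂ ins) = ray-⊥ i q (i≢q ∘ ≡.sym) (x≢q ∘ ≡.sym) ins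

theorem4p10 : (G : Graph) → HasMATLabeling G → StronglyChordal G
theorem4p10 G m = MAT⇒Chordal G m , MAT⇒sun-free G m
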